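{- Let $A$ be a type and $t$ a $\lambda\mu$-term. Then $t \in |A|$ if and only if there exists a closed term $t'$ such that $t \triangleright^* t'$ and $\vdash t' : A$ (i.e. $t'$ is typable with type $A$ in empty contexts).
   Context: $\lambda\mu$-terms: fix two disjoint infinite sets of variables, the $\lambda$-variables ($x,y,\dots$) and the $\mu$-variables ($\alpha,\beta,\dots$). Terms are given by $t ::= x \mid \lambda x.t \mid (t\,t) \mid \mu\alpha.t \mid (\alpha\,t)$, where $\lambda x$ and $\mu\alpha$ are binders (terms are taken up to renaming of bound variables). For terms $u,v$ and a $\mu$-variable $\alpha$, $u[\alpha:=^*v]$ is obtained from $u$ by replacing inductively each subterm of the form $(\alpha\,w)$ by $(\alpha\,(w\,v))$. One-step reduction $\triangleright$ is the compatible closure of $(\lambda x.u\;v)\triangleright u[x:=v]$ and $(\mu\alpha.u\;v)\triangleright \mu\alpha.u[\alpha:=^*v]$; $\triangleright^*$ is its reflexive transitive closure. For a finite sequence $\bar u=u_1\dots u_n$ of terms, $(t\,\bar u)$ denotes $(\dots(t\,u_1)\dots u_n)$, with $(t\,\emptyset)=t$; $\mathcal{T}$ is the set of terms and $\mathcal{T}^{<\omega}$ the set of finite sequences of terms. Types: $A ::= X \mid \perp \mid A\to A$, with $X$ ranging over an infinite set $\mathcal{P}$ of propositional variables and $\perp$ a constant. Typing judgements $\Gamma\vdash t:A\,;\Delta$, with $\Gamma$ a set of declarations $x:A$ (distinct $\lambda$-variables) and $\Delta$ a set of declarations $\alpha:B$ (distinct $\mu$-variables), are derived by: (ax) $\Gamma\vdash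 x:A;\Delta$ if $x:A\in\Gamma$; ($\to_i$) from $\Gamma,x:A\vdash t:B;\Delta$ infer $\Gamma\vdash\lambda x.t:A\to B;\Delta$; ($\to_e$) from $\Gamma\vdash u:A\to B;\Delta$ and $\Gamma\vdash v:A;\Delta$ infer $\Gamma\vdash(u\,v):B;\Delta$; ($\mu$) from $\Gamma\vdash t:\perp;\Delta,\alpha:A$ infer $\Gamma\vdash\mu\alpha.t:A;\Delta$; ($\perp$) from $\Gamma\vdash t:A;\Delta,\alpha:A$ infer $\Gamma\vdash(\alpha\,t):\perp;\Delta,\alpha:A$. $\vdash t:A$ means both contexts are empty. Semantics: a set $\mathcal S$ of terms is saturated if whenever $v\triangleright^* u$ and $u\in\mathcal S$ then $v\in\mathcal S$. For sets of terms $\mathcal K,\mathcal L$, $\mathcal K\leadsto\mathcal L=\{t \mid \forall u\in\mathcal K,\ (t\,u)\in\mathcal L\}$; for $\mathcal X\subseteq\mathcal T^{<\omega}$, $\mathcal X\leadsto\mathcal L=\{t\mid \forall\bar u\in\mathcal X,\ (t\,\bar u)\in\mathcal L\}$. A model $\mathcal M=\langle(\mathcal C_i)_{i\in I},(\mathcal B_i)_{i\in I},(R_j)_{j\in J}\rangle$ consists of subsets $I,J\subseteq\mathbb N$ with $0\in I$, pairwise disjoint infinite sets $\mathcal C_i$ of $\mu$-variables, and non-empty saturated sets of terms $\mathcal B_i$, $R_j$, such that: for all $i\in I$, $\alpha\in\mathcal C_i$ and $u\in\mathcal B_0$, $\mu\alpha.u\in\mathcal B_i$; for all $i\in I$, $\alpha\in\mathcal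 C_i$ and $u\in\mathcal B_i$, $(\alpha\,u)\in\mathcal B_0$; for every $j\in J$ there are $i\in I$ and $\mathcal X_j\subseteq\mathcal T^{<\omega}$ with $R_j=\mathcal X_j\leadsto\mathcal B_i$. $|\mathcal M|$ is the smallest set of sets of terms containing all $\mathcal B_i$ and $R_j$ and closed under $\leadsto$. An $\mathcal M$-interpretation is a map $\mathcal I:\mathcal P\to|\mathcal M|$, extended by $\mathcal I(\perp)=\mathcal B_0$, $\mathcal I(A\to B)=\mathcal I(A)\leadsto\mathcal I(B)$. $|A|_{\mathcal M}=\bigcap\{\mathcal I(A)\mid \mathcal I$ an $\mathcal M$-interpretation$\}$ and $|A|=\bigcap\{|A|_{\mathcal M}\mid\mathcal M$ a model$\}$. -}

module Defs where

open import Data.Nat using (ℕ; zero; suc; _≤_; _<ᵇ_; _≡ᵇ_; _∸_)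
open import Data.Bool using (Bool; true; false; if_then_else_)
open import Data.List using (List; []; _∷_)
open import Data.Product using (Σ; ∃; _×_; _,_)
open import Data.Empty using (⊥)
open import Relation.Binary.PropositionalEquality using (_≡_; _≢_)
open import Relation.Binary.Construct.Closure.ReflexiveTransitive using (Star)

-- λμ-terms, de Bruijn representation (= terms up to renaming of bound
-- variables).  Two separate index spaces: λ-variables (var) count λ
-- binders, μ-variables (nam) count μ binders.  An index larger than the
-- number of enclosing binders of its kind denotes a free variable:
-- at top level, `var x` is the free λ-variable x and `nam α t` is (α t)
-- for the free μ-variable α (both variable sets are ℕ, infinite).

data Term : Set where
  var : ℕ → Term
  lam : Term → Term
  app : Term → Term → Term
  mu  : Term → Term
  nam : ℕ → Term → Term

lift : (ℕ → ℕ) → ℕ → ℕ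
lift ρ zero    = zero
lift ρ (suc n) = suc (ρ n)

renλ : (ℕ → ℕ) → Term → Term
renλ ρ (var x)   = var (ρ x)
renλ ρ (lam t)   = lam (renλ (lift ρ) t)
renλ ρ (app t u) = app (renλ ρ t) (renλ ρ u)
renλ ρ (mu t)    = mu (renλ ρ t)
renλ ρ (nam α t) = nam α (renλ ρ t)

renμ : (ℕ → ℕ) → Term → Term
renμ ρ (var x)   = var x
renμ ρ (lam t)   = lam (renμ ρ t)
renμ ρ (app t u) = app (renμ ρ t) (renμ ρ u)
renμ ρ (mu t)    = mu (renμ (lift ρ) t)
renμ ρ (nam α t) = nam (ρ α) (renμ ρ t)

shiftλ : Term → Term
shiftλ = renλ suc

shiftμ : Term → Term
shiftμ = renμ suc

-- sub k v t : substitute v for λ-index k in t (v already adapted to the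
-- current depth), decrementing the λ-indices above k.
sub : ℕ → Term → Term → Term
sub k v (var x) = if x <ᵇ k then var x else (if x ≡ᵇ k then v else var (x ∸ 1))
sub k v (lam t)   = lam (sub (suc k) (shiftλ v) t)
sub k v (app t u) = app (sub k v t) (sub k v u)
sub k v (mu t)    = mu (sub k (shiftμ v) t)
sub k v (nam α t) = nam α (sub k v t)

msub : ℕ → Term → Term → Term
msub k v (var x)   = var x
msub k v (lam t)   = lam (msub k (shiftλ v) t)
msub k v (app t u) = app (msub k v t) (msub k v u)
msub k v (mu t)    = mu (msub (suc k) (shiftμ v) t)
msub k v (nam α t) =
  if α ≡ᵇ k then nam α (app (msub k v t) v) else nam α (msub k v t)

-- μα.u for a free μ-variable α : bind α (other free μ-variables unchanged)
bindμ : ℕ → ℕ → ℕ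
bindμ α β = if β ≡ᵇ α then zero else suc β

μ[_]_ : ℕ → Term → Term
μ[ α ] u = mu (renμ (bindμ α) u)

infix 4 _▷_ _▷*_

data _▷_ : Term → Term → Set where
  β-red : ∀ {u v} → app (lam u) v ▷ sub 0 v u
  μ-red : ∀ {u v} → app (mu u) v ▷ mu (msub 0 (shiftμ v) u)
  c-lam : ∀ {t t'} → t ▷ t' → lam t ▷ lam t'
  c-appl : ∀ {t t' u} → t ▷ t' → app t u ▷ app t' u
  c-appr : ∀ {t u u'} → u ▷ u' → app t u ▷ app t u'
  c-mu : ∀ {t t'} → t ▷ t' → mu t ▷ mu t'
  c-nam : ∀ {α t t'} → t ▷ t' → nam α t ▷ nam α t'

_▷*_ : Term → Term → Set
_▷*_ = Star _▷_

data Scoped : ℕ → ℕ → Term → Set where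
  s-var : ∀ {n m x} → suc x ≤ n → Scoped n m (var x)
  s-lam : ∀ {n m t} → Scoped (suc n) m t → Scoped n m (lam t)
  s-app : ∀ {n m t u} → Scoped n m t → Scoped n m u → Scoped n m (app t u)
  s-mu  : ∀ {n m t} → Scoped n (suc m) t → Scoped n m (mu t)
  s-nam : ∀ {n m α t} → suc α ≤ m → Scoped n m t → Scoped n m (nam α t)

Closed : Term → Set
Closed = Scoped 0 0

infixr 7 _⇒_

data Ty : Set where
  atom : ℕ → Ty
  bot  : Ty
  _⇒_  : Ty → Ty → Ty

data _∋_∶_ : List Ty → ℕ → Ty → Set where
  here  : ∀ {Γ A} → (A ∷ Γ) ∋ zero ∶ A
  there : ∀ {Γ A B k} → Γ ∋ k ∶ A → (B ∷ Γ) ∋ suc k ∶ A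

infix 3 _⊢_∶_⨾_

data _⊢_∶_⨾_ : List Ty → Term → Ty → List Ty → Set where
  ax   : ∀ {Γ Δ x A} → Γ ∋ x ∶ A → Γ ⊢ var x ∶ A ⨾ Δ
  →i   : ∀ {Γ Δ t A B} → (A ∷ Γ) ⊢ t ∶ B ⨾ Δ → Γ ⊢ lam t ∶ A ⇒ B ⨾ Δ
  →e   : ∀ {Γ Δ u v A B} → Γ ⊢ u ∶ A ⇒ B ⨾ Δ → Γ ⊢ v ∶ A ⨾ Δ → Γ ⊢ app u v ∶ B ⨾ Δ
  μ-rule : ∀ {Γ Δ t A} → Γ ⊢ t ∶ bot ⨾ (A ∷ Δ) → Γ ⊢ mu t ∶ A ⨾ Δ
  ⊥-rule : ∀ {Γ Δ α t A} → Δ ∋ α ∶ A → Γ ⊢ t ∶ A ⨾ Δ → Γ ⊢ nam α t ∶ bot ⨾ Δ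

TSet : Set₁
TSet = Term → Set

Saturated : TSet → Set
Saturated S = ∀ {v u} → v ▷* u → S u → S v

NonEmpty : TSet → Set
NonEmpty S = ∃ λ t → S t

_↝_ : TSet → TSet → TSet
(K ↝ L) t = ∀ u → K u → L (app t u)

apps : Term → List Term → Term
apps t []       = t
apps t (u ∷ us) = apps (app t u) us

_↝*_ : (List Term → Set) → TSet → TSet
(X ↝* L) t = ∀ us → X us → L (apps t us)

_≐_ : TSet → TSet → Set
S ≐ S' = ∀ t → (S t → S' t) × (S' t → S t)

Infinite : (ℕ → Set) → Set
Infinite P = ∀ n → ∃ λ m → n ≤ m × P m

record Model : Set₁ where
  field
    I J : ℕ → Set
    0∈I : I 0
    C : ℕ → ℕ → Set
    B : ℕ → TSet
    R : ℕ → TSet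
    C-infinite : ∀ i → I i → Infinite (C i)
    C-disjoint : ∀ i j → I i → I j → i ≢ j → ∀ α → C i α → C j α → ⊥
    B-nonempty : ∀ i → I i → NonEmpty (B i)
    B-saturated : ∀ i → I i → Saturated (B i)
    R-nonempty : ∀ j → J j → NonEmpty (R j)
    R-saturated : ∀ j → J j → Saturated (R j)
    μ-closed : ∀ i → I i → ∀ α → C i α → ∀ u → B 0 u → B i (μ[ α ] u)
    nam-closed : ∀ i → I i → ∀ α → C i α → ∀ u → B i u → B 0 (nam α u)
    R-index : ℕ → ℕ
    R-X : ℕ → List Term → Set
    R-form : ∀ j → J j → I (R-index j) × (R j ≐ (R-X j ↝* B (R-index j)))

-- |M| : the smallest set of sets of terms containing all ℬ_i, R_j and
-- closed under ↝ — presented by codes and their denotation.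
module _ (M : Model) where
  open Model M

  data Code : Set where
    cB : (i : ℕ) → I i → Code
    cR : (j : ℕ) → J j → Code
    c↝ : Code → Code → Code

  ⟦_⟧c : Code → TSet
  ⟦ cB i _ ⟧c = B i
  ⟦ cR j _ ⟧c = R j
  ⟦ c↝ a b ⟧c = ⟦ a ⟧c ↝ ⟦ b ⟧c

  Interp : Set
  Interp = ℕ → Code

  ⟦_⟧ty : Ty → Interp → TSet
  ⟦ atom X ⟧ty ℐ = ⟦ ℐ X ⟧c
  ⟦ bot ⟧ty ℐ = B 0
  ⟦ A ⇒ A' ⟧ty ℐ = ⟦ A ⟧ty ℐ ↝ ⟦ A' ⟧ty ℐ

  ∣_∣[M] : Ty → TSet
  ∣ A ∣[M] t = ∀ (ℐ : Interp) → ⟦ A ⟧ty ℐ t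

∣_∣ : Ty → Term → Set₁
∣ A ∣ t = ∀ (M : Model) → ∣_∣[M] M A t

{-# OPTIONS --safe #-}

-- Soundness: every set in |M| has the form 𝒳 ↝* ℬ_i, so a realizer of A may be tested on the
-- sequences of 𝒳; there μα.t consumes its arguments, and α can be taken fresh in 𝒞_i.
-- Completeness: fix infinite contexts that declare no free variable of t, and let ℬ_T be the
-- terms reducing to a term of type T. Interpreting atoms by their ℬ_X, every type A is then
-- interpreted by ℬ_A. The only hard inclusion is that of ℬ_A ↝ ℬ_B in ℬ_(A → B): if (t x) with
-- x : A reduces to a term of type B, then t reduces to a term of type A → B. Recording where the
-- argument x went, every reduction of (t x) lifts to one of t, and types transfer backwards.

module Submission where

open import Defs
open import Data.Bool using (Bool; true; false; T)
open import Data.Empty using (⊥; ⊥-elim)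
open import Data.List using (List; []; _∷_; _++_; _∷ʳ_; map; length)
open import Data.List.Properties using (map-∘; map-cong; map-++; ++-assoc; ++-identityʳ)
open import Data.Nat using (ℕ; zero; suc; _+_; _≤_; _<_; _≡ᵇ_; _<ᵇ_; _⊔_; z≤n; s≤s)
open import Data.Nat.Properties
  using (≤-refl; ≤-trans; m≤m⊔n; m≤n⊔m; m≤m+n; m≤n+m; n≤1+n;
    +-suc; +-identityʳ; +-cancelˡ-≡; <⇒≱; n≮n; ≡ᵇ⇒≡; ≡⇒≡ᵇ)
open import Data.Product using (∃; _×_; _,_; proj₁; proj₂)
open import Data.Unit using (⊤; tt)
open import Function using (_∘_; id)
open import Relation.Binary.Construct.Closure.ReflexiveTransitive using (ε; _◅_; _◅◅_; gmap)
open import Relation.Binary.PropositionalEquality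

infixr 5 _◂_

_◂_ : ∀ {a} {A : Set a} → A → (ℕ → A) → ℕ → A
(a ◂ f) zero    = a
(a ◂ f) (suc n) = f n

-- Renamings and substitutions

lift-square : ∀ {ρ₁ ρ₂ ρ₃ ρ₄ : ℕ → ℕ} → (∀ x → ρ₁ (ρ₂ x) ≡ ρ₃ (ρ₄ x)) →
  ∀ x → lift ρ₁ (lift ρ₂ x) ≡ lift ρ₃ (lift ρ₄ x)
lift-square e zero    = refl
lift-square e (suc x) = cong suc (e x)

lift-id : ∀ {ρ} → (∀ x → ρ x ≡ x) → ∀ x → lift ρ x ≡ x
lift-id e zero    = refl
lift-id e (suc x) = cong suc (e x)

-- Stated for a commuting square because `lift` preserves such squares pointwise; with an identity
-- on one side it also gives plain fusion laws.
renλ-square : ∀ {ρ₁ ρ₂ ρ₃ ρ₄} → (∀ x → ρ₁ (ρ₂ x) ≡ ρ₃ (ρ₄ x)) →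
  ∀ t → renλ ρ₁ (renλ ρ₂ t) ≡ renλ ρ₃ (renλ ρ₄ t)
renλ-square e (var x)   = cong var (e x)
renλ-square e (lam t)   = cong lam (renλ-square (lift-square e) t)
renλ-square e (app t u) = cong₂ app (renλ-square e t) (renλ-square e u)
renλ-square e (mu t)    = cong mu (renλ-square e t)
renλ-square e (nam α t) = cong (nam α) (renλ-square e t)

renμ-square : ∀ {ρ₁ ρ₂ ρ₃ ρ₄} → (∀ x → ρ₁ (ρ₂ x) ≡ ρ₃ (ρ₄ x)) →
  ∀ t → renμ ρ₁ (renμ ρ₂ t) ≡ renμ ρ₃ (renμ ρ₄ t)
renμ-square e (var x)   = refl
renμ-square e (lam t)   = cong lam (renμ-square e t)
renμ-square e (app t u) = cong₂ app (renμ-square e t) (renμ-square e u)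
renμ-square e (mu t)    = cong mu (renμ-square (lift-square e) t)
renμ-square e (nam α t) = cong₂ nam (e α) (renμ-square e t)

renλ-id : ∀ {ρ} → (∀ x → ρ x ≡ x) → ∀ t → renλ ρ t ≡ t
renλ-id e (var x)   = cong var (e x)
renλ-id e (lam t)   = cong lam (renλ-id (lift-id e) t)
renλ-id e (app t u) = cong₂ app (renλ-id e t) (renλ-id e u)
renλ-id e (mu t)    = cong mu (renλ-id e t)
renλ-id e (nam α t) = cong (nam α) (renλ-id e t)

renμ-renλ : ∀ {κ ρ} t → renμ κ (renλ ρ t) ≡ renλ ρ (renμ κ t)
renμ-renλ (var x)   = refl
renμ-renλ (lam t)   = cong lam (renμ-renλ t)
renμ-renλ (app t u) = cong₂ app (renμ-renλ t) (renμ-renλ u)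
renμ-renλ (mu t)    = cong mu (renμ-renλ t)
renμ-renλ (nam α t) = cong (nam _) (renμ-renλ t)

shiftλ-renλ : ∀ {ρ} t → shiftλ (renλ ρ t) ≡ renλ (lift ρ) (shiftλ t)
shiftλ-renλ = renλ-square (λ _ → refl)

shiftμ-renμ : ∀ {κ} t → shiftμ (renμ κ t) ≡ renμ (lift κ) (shiftμ t)
shiftμ-renμ = renμ-square (λ _ → refl)

↑ : (ℕ → Term) → ℕ → Term
↑ θ = var zero ◂ (shiftλ ∘ θ)

-- The parallel form of `sub`: its laws need only pointwise hypotheses on `θ`, which survive every
-- binder.
substλ : (ℕ → Term) → Term → Term
substλ θ (var x)   = θ x
substλ θ (lam t)   = lam (substλ (↑ θ) t)
substλ θ (app t u) = app (substλ θ t) (substλ θ u)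
substλ θ (mu t)    = mu (substλ (shiftμ ∘ θ) t)
substλ θ (nam α t) = nam α (substλ θ t)

substλ-renλ : ∀ {θ θ' ρ} → (∀ x → θ (ρ x) ≡ θ' x) → ∀ t → substλ θ (renλ ρ t) ≡ substλ θ' t
substλ-renλ e (var x)   = e x
substλ-renλ e (lam t)   =
  cong lam (substλ-renλ (λ { zero → refl ; (suc x) → cong shiftλ (e x) }) t)
substλ-renλ e (app t u) = cong₂ app (substλ-renλ e t) (substλ-renλ e u)
substλ-renλ e (mu t)    = cong mu (substλ-renλ (cong shiftμ ∘ e) t)
substλ-renλ e (nam α t) = cong (nam α) (substλ-renλ e t)

renλ-substλ : ∀ {θ θ' ρ} → (∀ x → renλ ρ (θ x) ≡ θ' x) → ∀ t → renλ ρ (substλ θ t) ≡ substλ θ' t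
renλ-substλ e (var x)   = e x
renλ-substλ {θ} e (lam t) = cong lam (renλ-substλ
  (λ { zero → refl ; (suc x) → trans (sym (shiftλ-renλ (θ x))) (cong shiftλ (e x)) }) t)
renλ-substλ e (app t u) = cong₂ app (renλ-substλ e t) (renλ-substλ e u)
renλ-substλ {θ} e (mu t) = cong mu (renλ-substλ
  (λ x → trans (sym (renμ-renλ (θ x))) (cong shiftμ (e x))) t)
renλ-substλ e (nam α t) = cong (nam α) (renλ-substλ e t)

substλ-id : ∀ {θ} → (∀ x → θ x ≡ var x) → ∀ t → substλ θ t ≡ t
substλ-id e (var x)   = e x
substλ-id e (lam t)   = cong lam (substλ-id (λ { zero → refl ; (suc x) → cong shiftλ (e x) }) t)
substλ-id e (app t u) = cong₂ app (substλ-id e t) (substλ-id e u)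
substλ-id e (mu t)    = cong mu (substλ-id (cong shiftμ ∘ e) t)
substλ-id e (nam α t) = cong (nam α) (substλ-id e t)

renμ-substλ : ∀ {θ θ' κ} → (∀ x → renμ κ (θ x) ≡ θ' x) →
  ∀ t → renμ κ (substλ θ t) ≡ substλ θ' (renμ κ t)
renμ-substλ e (var x)   = e x
renμ-substλ {θ} e (lam t) = cong lam (renμ-substλ
  (λ { zero → refl ; (suc x) → trans (renμ-renλ (θ x)) (cong shiftλ (e x)) }) t)
renμ-substλ e (app t u) = cong₂ app (renμ-substλ e t) (renμ-substλ e u)
renμ-substλ {θ} e (mu t) = cong mu (renμ-substλ
  (λ x → trans (sym (shiftμ-renμ (θ x))) (cong shiftμ (e x))) t)
renμ-substλ e (nam α t) = cong (nam _) (renμ-substλ e t)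

substλ-shiftλ : ∀ θ t → substλ (↑ θ) (shiftλ t) ≡ shiftλ (substλ θ t)
substλ-shiftλ θ t = trans (substλ-renλ (λ _ → refl) t) (sym (renλ-substλ (λ _ → refl) t))

substλ-shiftμ : ∀ θ t → substλ (shiftμ ∘ θ) (shiftμ t) ≡ shiftμ (substλ θ t)
substλ-shiftμ θ t = sym (renμ-substλ (λ _ → refl) t)

substλ-◂-shiftλ : ∀ u t → substλ (u ◂ var) (shiftλ t) ≡ t
substλ-◂-shiftλ u t = trans (substλ-renλ (λ _ → refl) t) (substλ-id (λ _ → refl) t)

sub-var-suc : ∀ k v x → sub (suc k) (shiftλ v) (var (suc x)) ≡ shiftλ (sub k v (var x))
sub-var-suc zero    v zero    = refl
sub-var-suc (suc k) v zero    = refl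
sub-var-suc k       v (suc x) with suc x <ᵇ k | suc x ≡ᵇ k
... | true  | _     = refl
... | false | true  = refl
... | false | false = refl

renμ-sub-var : ∀ κ k v x → renμ κ (sub k v (var x)) ≡ sub k (renμ κ v) (var x)
renμ-sub-var κ k v x with x <ᵇ k | x ≡ᵇ k
... | true  | _     = refl
... | false | true  = refl
... | false | false = refl

-- Agreement on variables suffices, since `sub-var-suc` and `renμ-sub-var` carry it under λ and μ.
sub≡substλ : ∀ {k v θ} → (∀ x → sub k v (var x) ≡ θ x) → ∀ t → sub k v t ≡ substλ θ t
sub≡substλ e (var x)   = e x
sub≡substλ {k} {v} e (lam t) = cong lam (sub≡substλ
  (λ { zero → refl ; (suc x) → trans (sub-var-suc k v x) (cong shiftλ (e x)) }) t)
sub≡substλ e (app t u) = cong₂ app (sub≡substλ e t) (sub≡substλ e u)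
sub≡substλ {k} {v} e (mu t) = cong mu (sub≡substλ
  (λ x → trans (sym (renμ-sub-var suc k v x)) (cong shiftμ (e x))) t)
sub≡substλ e (nam α t) = cong (nam α) (sub≡substλ e t)

sub₀≡substλ : ∀ v t → sub 0 v t ≡ substλ (v ◂ var) t
sub₀≡substλ v = sub≡substλ (λ { zero → refl ; (suc x) → refl })

renμ-sub : ∀ κ k v t → renμ κ (sub k v t) ≡ sub k (renμ κ v) (renμ κ t)
renμ-sub κ k v (var x)   = renμ-sub-var κ k v x
renμ-sub κ k v (lam t)   = cong lam (trans (renμ-sub κ (suc k) (shiftλ v) t)
  (cong (λ w → sub (suc k) w (renμ κ t)) (renμ-renλ v)))
renμ-sub κ k v (app t u) = cong₂ app (renμ-sub κ k v t) (renμ-sub κ k v u)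
renμ-sub κ k v (mu t)    = cong mu (trans (renμ-sub (lift κ) k (shiftμ v) t)
  (cong (λ w → sub k w (renμ (lift κ) t)) (sym (shiftμ-renμ v))))
renμ-sub κ k v (nam α t) = cong (nam _) (renμ-sub κ k v t)

lift-≡ᵇ : ∀ {κ k k'} → (∀ α → (κ α ≡ᵇ k') ≡ (α ≡ᵇ k)) → ∀ α → (lift κ α ≡ᵇ suc k') ≡ (α ≡ᵇ suc k)
lift-≡ᵇ e zero    = refl
lift-≡ᵇ e (suc α) = e α

-- `msub` only compares names with `k`, so `κ` must neither lose nor create a match; it need not be
-- injective elsewhere.
renμ-msub : ∀ {κ k k'} v → (∀ α → (κ α ≡ᵇ k') ≡ (α ≡ᵇ k)) →
  ∀ t → renμ κ (msub k v t) ≡ msub k' (renμ κ v) (renμ κ t)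
renμ-msub v e (var x)   = refl
renμ-msub {κ} {k' = k'} v e (lam t) = cong lam (trans (renμ-msub (shiftλ v) e t)
  (cong (λ w → msub k' w (renμ κ t)) (renμ-renλ v)))
renμ-msub v e (app t u) = cong₂ app (renμ-msub v e t) (renμ-msub v e u)
renμ-msub {κ} {k' = k'} v e (mu t) = cong mu (trans (renμ-msub (shiftμ v) (lift-≡ᵇ e) t)
  (cong (λ w → msub (suc k') w (renμ (lift κ) t)) (sym (shiftμ-renμ v))))
renμ-msub {κ} {k} v e (nam α t) rewrite e α with α ≡ᵇ k
... | true  = cong (λ w → nam (κ α) (app w (renμ κ v))) (renμ-msub v e t)
... | false = cong (nam (κ α)) (renμ-msub v e t)

renλ-msub : ∀ {ρ} k v t → renλ ρ (msub k v t) ≡ msub k (renλ ρ v) (renλ ρ t)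
renλ-msub k v (var x)   = refl
renλ-msub {ρ} k v (lam t) = cong lam (trans (renλ-msub k (shiftλ v) t)
  (cong (λ w → msub k w (renλ (lift ρ) t)) (sym (shiftλ-renλ v))))
renλ-msub k v (app t u) = cong₂ app (renλ-msub k v t) (renλ-msub k v u)
renλ-msub {ρ} k v (mu t) = cong mu (trans (renλ-msub (suc k) (shiftμ v) t)
  (cong (λ w → msub (suc k) w (renλ ρ t)) (sym (renμ-renλ v))))
renλ-msub {ρ} k v (nam α t) with α ≡ᵇ k
... | true  = cong (λ w → nam α (app w (renλ ρ v))) (renλ-msub k v t)
... | false = cong (nam α) (renλ-msub k v t)

msub-renμ-fresh : ∀ {κ k v} → (∀ α → (κ α ≡ᵇ k) ≡ false) → ∀ t → msub k v (renμ κ t) ≡ renμ κ t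
msub-renμ-fresh e (var x)   = refl
msub-renμ-fresh e (lam t)   = cong lam (msub-renμ-fresh e t)
msub-renμ-fresh e (app t u) = cong₂ app (msub-renμ-fresh e t) (msub-renμ-fresh e u)
msub-renμ-fresh e (mu t)    =
  cong mu (msub-renμ-fresh (λ { zero → refl ; (suc α) → e α }) t)
msub-renμ-fresh e (nam α t) rewrite e α = cong (nam _) (msub-renμ-fresh e t)

-- Any `κ` will do: a μ-step substitutes for the bound name 0 only, and `lift κ` sends 0, and
-- nothing else, to 0.
renμ-▷ : ∀ {κ t t'} → t ▷ t' → renμ κ t ▷ renμ κ t'
renμ-▷ {κ} (β-red {u} {v}) =
  subst (app (lam (renμ κ u)) (renμ κ v) ▷_) (sym (renμ-sub κ 0 v u)) β-red
renμ-▷ {κ} (μ-red {u} {v}) =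
  subst (λ w → app (mu (renμ (lift κ) u)) (renμ κ v) ▷ mu w)
    (trans (cong (λ w → msub 0 w (renμ (lift κ) u)) (shiftμ-renμ v))
      (sym (renμ-msub (shiftμ v) (λ { zero → refl ; (suc α) → refl }) u)))
    μ-red
renμ-▷ (c-lam r)  = c-lam (renμ-▷ r)
renμ-▷ (c-appl r) = c-appl (renμ-▷ r)
renμ-▷ (c-appr r) = c-appr (renμ-▷ r)
renμ-▷ (c-mu r)   = c-mu (renμ-▷ r)
renμ-▷ (c-nam r)  = c-nam (renμ-▷ r)

-- Application to a sequence of terms

apps-▷* : ∀ {t t'} us → t ▷* t' → apps t us ▷* apps t' us
apps-▷* []       r = r
apps-▷* (u ∷ us) r = apps-▷* us (gmap (λ t → app t u) c-appl r)

apps-∷ʳ : ∀ t us v → apps t (us ∷ʳ v) ≡ app (apps t us) v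
apps-∷ʳ t []       v = refl
apps-∷ʳ t (u ∷ us) v = apps-∷ʳ (app t u) us v

apps-map : ∀ {f : Term → Term} → (∀ t u → f (app t u) ≡ app (f t) (f u)) →
  ∀ t us → f (apps t us) ≡ apps (f t) (map f us)
apps-map e t []       = refl
apps-map {f} e t (u ∷ us) =
  trans (apps-map e (app t u) us) (cong (λ w → apps w (map f us)) (e t u))

map-square : ∀ {f g h k : Term → Term} → (∀ t → f (g t) ≡ h (k t)) →
  ∀ us → map f (map g us) ≡ map h (map k us)
map-square e us = trans (sym (map-∘ us)) (trans (map-cong e us) (map-∘ us))

map-cancel : ∀ {f g : Term → Term} → (∀ t → f (g t) ≡ t) → ∀ us → map f (map g us) ≡ us
map-cancel e []       = refl
map-cancel e (u ∷ us) = cong₂ _∷_ (e u) (map-cancel e us)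

-- Adequacy

-- The simultaneous substitution [x := σ x] [α :=* η α], which moreover renames α to ν α.
inst : (ℕ → Term) → (ℕ → ℕ) → (ℕ → List Term) → Term → Term
inst σ ν η (var x)   = σ x
inst σ ν η (lam t)   = lam (inst (↑ σ) ν (map shiftλ ∘ η) t)
inst σ ν η (app t u) = app (inst σ ν η t) (inst σ ν η u)
inst σ ν η (mu t)    = mu (inst (shiftμ ∘ σ) (lift ν) ([] ◂ (map shiftμ ∘ η)) t)
inst σ ν η (nam α t) = nam (ν α) (apps (inst σ ν η t) (η α))

substλ-inst : ∀ {θ σ σ' ν η η'} → (∀ x → substλ θ (σ x) ≡ σ' x) →
  (∀ α → map (substλ θ) (η α) ≡ η' α) → ∀ t → substλ θ (inst σ ν η t) ≡ inst σ' ν η' t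
substλ-inst es eη (var x) = es x
substλ-inst {θ} {σ} {η = η} es eη (lam t) = cong lam (substλ-inst
  (λ { zero → refl ; (suc x) → trans (substλ-shiftλ θ (σ x)) (cong shiftλ (es x)) })
  (λ α → trans (map-square (substλ-shiftλ θ) (η α)) (cong (map shiftλ) (eη α))) t)
substλ-inst es eη (app t u) = cong₂ app (substλ-inst es eη t) (substλ-inst es eη u)
substλ-inst {θ} {σ} {η = η} es eη (mu t) = cong mu (substλ-inst
  (λ x → trans (substλ-shiftμ θ (σ x)) (cong shiftμ (es x)))
  (λ { zero → refl
     ; (suc α) → trans (map-square (substλ-shiftμ θ) (η α)) (cong (map shiftμ) (eη α)) }) t)
substλ-inst {η = η} es eη (nam α t) = cong (nam _)
  (trans (apps-map (λ _ _ → refl) _ (η α)) (cong₂ apps (substλ-inst es eη t) (eη α)))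

renμ-inst : ∀ {κ σ σ' ν ν' η η'} → (∀ x → renμ κ (σ x) ≡ σ' x) → (∀ α → κ (ν α) ≡ ν' α) →
  (∀ α → map (renμ κ) (η α) ≡ η' α) → ∀ t → renμ κ (inst σ ν η t) ≡ inst σ' ν' η' t
renμ-inst es eν eη (var x) = es x
renμ-inst {σ = σ} {η = η} es eν eη (lam t) = cong lam (renμ-inst
  (λ { zero → refl ; (suc x) → trans (renμ-renλ (σ x)) (cong shiftλ (es x)) })
  eν
  (λ α → trans (map-square renμ-renλ (η α)) (cong (map shiftλ) (eη α))) t)
renμ-inst es eν eη (app t u) = cong₂ app (renμ-inst es eν eη t) (renμ-inst es eν eη u)
renμ-inst {σ = σ} {η = η} es eν eη (mu t) = cong mu (renμ-inst
  (λ x → trans (sym (shiftμ-renμ (σ x))) (cong shiftμ (es x)))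
  (λ { zero → refl ; (suc α) → cong suc (eν α) })
  (λ { zero → refl
     ; (suc α) → trans (map-square (sym ∘ shiftμ-renμ) (η α)) (cong (map shiftμ) (eη α)) }) t)
renμ-inst {η = η} es eν eη (nam α t) = cong₂ nam (eν α)
  (trans (apps-map (λ _ _ → refl) _ (η α)) (cong₂ apps (renμ-inst es eν eη t) (eη α)))

shiftμ-msub : ∀ k v t → msub (suc k) (shiftμ v) (shiftμ t) ≡ shiftμ (msub k v t)
shiftμ-msub k v t = sym (renμ-msub v (λ _ → refl) t)

-- Absorbs a structural substitution into the environment: `σ` and `η` are unaffected by it, so it
-- acts only where `inst` itself outputs the name `k`, and there `v` joins the end of the stack.
msub-inst : ∀ {k v σ ν η η'} → (∀ x → msub k v (σ x) ≡ σ x) →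
  (∀ α → map (msub k v) (η α) ≡ η α) →
  (∀ α → (ν α ≡ᵇ k) ≡ true → η' α ≡ η α ∷ʳ v) →
  (∀ α → (ν α ≡ᵇ k) ≡ false → η' α ≡ η α) →
  ∀ t → msub k v (inst σ ν η t) ≡ inst σ ν η' t
msub-inst es eη et ef (var x) = es x
msub-inst {k} {v} {σ} {η = η} es eη et ef (lam t) = cong lam (msub-inst
  (λ { zero → refl
     ; (suc x) → trans (sym (renλ-msub k v (σ x))) (cong shiftλ (es x)) })
  (λ α → trans (map-square (sym ∘ renλ-msub k v) (η α)) (cong (map shiftλ) (eη α)))
  (λ α e → trans (cong (map shiftλ) (et α e)) (map-++ shiftλ (η α) (v ∷ [])))
  (λ α e → cong (map shiftλ) (ef α e)) t)
msub-inst es eη et ef (app t u) =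
  cong₂ app (msub-inst es eη et ef t) (msub-inst es eη et ef u)
msub-inst {k} {v} {σ} {η = η} es eη et ef (mu t) = cong mu (msub-inst
  (λ x → trans (shiftμ-msub k v (σ x)) (cong shiftμ (es x)))
  (λ { zero → refl
     ; (suc α) → trans (map-square (shiftμ-msub k v) (η α)) (cong (map shiftμ) (eη α)) })
  (λ { zero ()
     ; (suc α) e → trans (cong (map shiftμ) (et α e)) (map-++ shiftμ (η α) (v ∷ [])) })
  (λ { zero _ → refl ; (suc α) e → cong (map shiftμ) (ef α e) }) t)
msub-inst {k} {v} {σ} {ν} {η} {η'} es eη et ef (nam α t)
  with ν α ≡ᵇ k | et α | ef α
... | true  | p | _ = cong (nam (ν α)) (begin
  app (msub k v (apps (inst σ ν η t) (η α))) v
    ≡⟨ cong (λ w → app w v) (apps-map (λ _ _ → refl) _ (η α)) ⟩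
  app (apps (msub k v (inst σ ν η t)) (map (msub k v) (η α))) v
    ≡⟨ cong₂ (λ w us → app (apps w us) v) (msub-inst es eη et ef t) (eη α) ⟩
  app (apps (inst σ ν η' t) (η α)) v
    ≡⟨ sym (apps-∷ʳ _ (η α) v) ⟩
  apps (inst σ ν η' t) (η α ∷ʳ v)
    ≡⟨ cong (apps _) (sym (p refl)) ⟩
  apps (inst σ ν η' t) (η' α) ∎)
  where open ≡-Reasoning
... | false | _ | q = cong (nam (ν α)) (trans (apps-map (λ _ _ → refl) _ (η α))
  (cong₂ apps (msub-inst es eη et ef t) (trans (eη α) (sym (q refl)))))

-- A typed term contains declared free variables only, so in empty contexts every environment acts
-- as the identity.
inst-id : ∀ {Γ Δ t A σ ν η} → Γ ⊢ t ∶ A ⨾ Δ → (∀ {x B} → Γ ∋ x ∶ B → σ x ≡ var x) →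
  (∀ {α B} → Δ ∋ α ∶ B → ν α ≡ α × η α ≡ []) → inst σ ν η t ≡ t
inst-id (ax x) es eμ = es x
inst-id (→i d) es eμ = cong lam (inst-id d
  (λ { here → refl ; (there x) → cong shiftλ (es x) })
  (λ a → proj₁ (eμ a) , cong (map shiftλ) (proj₂ (eμ a))))
inst-id (→e d e) es eμ = cong₂ app (inst-id d es eμ) (inst-id e es eμ)
inst-id (μ-rule d) es eμ = cong mu (inst-id d
  (λ x → cong shiftμ (es x))
  (λ { here → refl , refl
     ; (there a) → cong suc (proj₁ (eμ a)) , cong (map shiftμ) (proj₂ (eμ a)) }))
inst-id (⊥-rule a d) es eμ =
  cong₂ nam (proj₁ (eμ a)) (cong₂ apps (inst-id d es eμ) (proj₂ (eμ a)))

-- `us` holds the arguments already consumed, which makes induction on `vs` possible: each μ-step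
-- moves one argument from `vs` to the end of `us`.
apps-mu-▷* : ∀ {σ ν η} t us vs →
  apps (mu (inst (shiftμ ∘ σ) (lift ν) (map shiftμ us ◂ (map shiftμ ∘ η)) t)) vs
    ▷* mu (inst (shiftμ ∘ σ) (lift ν) (map shiftμ (us ++ vs) ◂ (map shiftμ ∘ η)) t)
apps-mu-▷* {σ} {ν} {η} t us [] rewrite ++-identityʳ us = ε
apps-mu-▷* {σ} {ν} {η} t us (v ∷ vs) = apps-▷* vs (μ-red ◅ ε) ◅◅
  subst₂ _▷*_
    (cong (λ w → apps (mu w) vs) (sym (msub-inst
      (λ x → fixed (σ x))
      (λ { zero → map-fixed us ; (suc α) → map-fixed (η α) })
      (λ { zero _ → map-++ shiftμ us (v ∷ []) ; (suc α) () })
      (λ { zero () ; (suc α) _ → refl }) t)))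
    (cong (λ ws → mu (inst (shiftμ ∘ σ) (lift ν) (map shiftμ ws ◂ (map shiftμ ∘ η)) t))
      (++-assoc us (v ∷ []) vs))
    (apps-mu-▷* t (us ∷ʳ v) vs)
  where
  fixed : ∀ u → msub 0 (shiftμ v) (shiftμ u) ≡ shiftμ u
  fixed = msub-renμ-fresh (λ _ → refl)
  map-fixed : ∀ ws → map (msub 0 (shiftμ v)) (map shiftμ ws) ≡ map shiftμ ws
  map-fixed ws = trans (sym (map-∘ ws)) (map-cong fixed ws)

-- Fresh μ-variables

-- Freshness in the form in which it is used: binding `α` captures nothing and merely shifts.
FreshFrom : ℕ → Term → Set
FreshFrom N t = ∀ α → N ≤ α → renμ (bindμ α) t ≡ shiftμ t

renμ-local : ∀ t → ∃ λ N → ∀ {κ κ'} → (∀ α → α < N → κ α ≡ κ' α) → renμ κ t ≡ renμ κ' t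
renμ-local (var x) = 0 , λ _ → refl
renμ-local (lam t) with renμ-local t
... | N , f = N , λ e → cong lam (f e)
renμ-local (app t u) with renμ-local t | renμ-local u
... | N , f | M , g = N ⊔ M , λ e → cong₂ app
  (f (λ α p → e α (≤-trans p (m≤m⊔n N M)))) (g (λ α p → e α (≤-trans p (m≤n⊔m N M))))
renμ-local (mu t) with renμ-local t
... | N , f = N , λ e → cong mu (f
  (λ { zero _ → refl ; (suc α) p → cong suc (e α (≤-trans (n≤1+n _) p)) }))
renμ-local (nam α t) with renμ-local t
... | N , f = suc α ⊔ N , λ e → cong₂ nam (e α (m≤m⊔n (suc α) N))
  (f (λ β p → e β (≤-trans p (m≤n⊔m (suc α) N))))

bindμ-fresh : ∀ {α β} → β < α → bindμ α β ≡ suc β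
bindμ-fresh {α} {β} p with β ≡ᵇ α in e
... | false = refl
... | true with refl ← ≡ᵇ⇒≡ β α (subst T (sym e) tt) = ⊥-elim (n≮n _ p)

bindμ-self : ∀ α → bindμ α α ≡ zero
bindμ-self α with α ≡ᵇ α in e
... | true  = refl
... | false = ⊥-elim (subst T e (≡⇒≡ᵇ α α refl))

freshFrom : ∀ t → ∃ λ N → FreshFrom N t
freshFrom t with renμ-local t
... | N , f = N , λ α p → f (λ β q → bindμ-fresh (≤-trans q p))

MapFreshFrom : ℕ → List Term → Set
MapFreshFrom N us = ∀ α → N ≤ α → map (renμ (bindμ α)) us ≡ map shiftμ us

mapFreshFrom : ∀ us → ∃ λ N → MapFreshFrom N us
mapFreshFrom [] = 0 , λ _ _ → refl
mapFreshFrom (u ∷ us) with freshFrom u | mapFreshFrom us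
... | N , f | M , g = N ⊔ M , λ α p → cong₂ _∷_
  (f α (≤-trans (m≤m⊔n N M) p)) (g α (≤-trans (m≤n⊔m N M) p))

-- Realizability in a model

module Soundness (M : Model) where
  open Model M

  -- As in classical realizability, membership is a test against a set `X` of stacks, with `B i` as
  -- the set of successful outcomes.
  Orthogonal : TSet → Set₁
  Orthogonal K = ∃ λ i → I i × ∃ λ X → K ≐ (X ↝* B i)

  ↝-saturated : ∀ {K L} → Saturated L → Saturated (K ↝ L)
  ↝-saturated sat r p u k = sat (gmap (λ t → app t u) c-appl r) (p u k)

  _∷*_ : TSet → (List Term → Set) → List Term → Set
  (K ∷* X) []       = ⊥
  (K ∷* X) (u ∷ us) = K u × X us

  -- Currying: the stacks for `K ↝ L` are those for `L` with an element of `K` pushed in front.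
  ↝-orthogonal : ∀ {K L} → Orthogonal L → Orthogonal (K ↝ L)
  ↝-orthogonal {K} (i , Ii , X , e) = i , Ii , (K ∷* X) , λ t →
    (λ { f [] () ; f (u ∷ us) (k , x) → proj₁ (e _) (f u k) us x }) ,
    (λ f u k → proj₂ (e _) (λ us x → f (u ∷ us) (k , x)))

  B-orthogonal : ∀ {i} → I i → Orthogonal (B i)
  B-orthogonal {i} Ii = i , Ii , (_≡ []) , λ t → (λ { b .[] refl → b }) , λ f → f [] refl

  code-saturated : ∀ c → Saturated (⟦_⟧c M c)
  code-saturated (cB i Ii) = B-saturated i Ii
  code-saturated (cR j Jj) = R-saturated j Jj
  code-saturated (c↝ a b)  = ↝-saturated (code-saturated b)

  code-orthogonal : ∀ c → Orthogonal (⟦_⟧c M c)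
  code-orthogonal (cB i Ii) = B-orthogonal Ii
  code-orthogonal (cR j Jj) = R-index j , proj₁ (R-form j Jj) , R-X j , proj₂ (R-form j Jj)
  code-orthogonal (c↝ a b)  = ↝-orthogonal (code-orthogonal b)

  module _ (ℐ : Interp M) where

    ⟦_⟧ : Ty → TSet
    ⟦ A ⟧ = ⟦_⟧ty M A ℐ

    saturated : ∀ A → Saturated ⟦ A ⟧
    saturated (atom X) = code-saturated (ℐ X)
    saturated bot      = B-saturated 0 0∈I
    saturated (A ⇒ B)  = ↝-saturated (saturated B)

    orthogonal : ∀ A → Orthogonal ⟦ A ⟧
    orthogonal (atom X) = code-orthogonal (ℐ X)
    orthogonal bot      = B-orthogonal 0∈I
    orthogonal (A ⇒ B)  = ↝-orthogonal (orthogonal B)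

    -- A name of type `A` receives a stack that sends `⟦ A ⟧` into some `B i`, together with a name
    -- from the matching class `C i`. As `σ` and `η` are infinite families, a uniform `bound` is
    -- kept, from which on names are fresh for all of them.
    record Realizes (Γ Δ : List Ty) (σ : ℕ → Term) (ν : ℕ → ℕ) (η : ℕ → List Term) : Set where
      field
        λ-real  : ∀ {x A} → Γ ∋ x ∶ A → ⟦ A ⟧ (σ x)
        μ-real  : ∀ {α A} → Δ ∋ α ∶ A →
          ∃ λ i → I i × C i (ν α) × (∀ {w} → ⟦ A ⟧ w → B i (apps w (η α)))
        bound   : ℕ
        σ-fresh : ∀ x → FreshFrom bound (σ x)
        ν-fresh : ∀ α → ν α < bound
        η-fresh : ∀ α → MapFreshFrom bound (η α)

    open Realizes

    extendλ : ∀ {Γ Δ σ ν η A u} → ⟦ A ⟧ u → Realizes Γ Δ σ ν η → Realizes (A ∷ Γ) Δ (u ◂ σ) ν η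
    extendλ {u = u} a E with freshFrom u
    ... | N , f = record
      { λ-real  = λ { here → a ; (there x) → λ-real E x }
      ; μ-real  = μ-real E
      ; bound   = N ⊔ bound E
      ; σ-fresh = λ { zero α p → f α (≤-trans (m≤m⊔n N _) p)
                    ; (suc x) α p → σ-fresh E x α (≤-trans (m≤n⊔m N _) p) }
      ; ν-fresh = λ α → ≤-trans (ν-fresh E α) (m≤n⊔m N _)
      ; η-fresh = λ β α p → η-fresh E β α (≤-trans (m≤n⊔m N _) p)
      }

    extendμ : ∀ {Γ Δ σ ν η A i α vs} → I i → C i α → (∀ {w} → ⟦ A ⟧ w → B i (apps w vs)) →
      Realizes Γ Δ σ ν η → Realizes Γ (A ∷ Δ) σ (α ◂ ν) (vs ◂ η)
    extendμ {i = i} {α} {vs} Ii Cα b E with mapFreshFrom vs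
    ... | N , f = record
      { λ-real  = λ-real E
      ; μ-real  = λ { here → i , Ii , Cα , b ; (there a) → μ-real E a }
      ; bound   = (N ⊔ suc α) ⊔ bound E
      ; σ-fresh = λ x β p → σ-fresh E x β (≤-trans (m≤n⊔m (N ⊔ suc α) _) p)
      ; ν-fresh = λ { zero → ≤-trans (m≤n⊔m N _) (m≤m⊔n (N ⊔ suc α) _)
                    ; (suc β) → ≤-trans (ν-fresh E β) (m≤n⊔m (N ⊔ suc α) _) }
      ; η-fresh = λ { zero β p → f β (≤-trans (m≤m⊔n N _) (≤-trans (m≤m⊔n (N ⊔ suc α) _) p))
                    ; (suc γ) β p → η-fresh E γ β (≤-trans (m≤n⊔m (N ⊔ suc α) _) p) }
      }

    adequacy : ∀ {Γ Δ t A σ ν η} → Γ ⊢ t ∶ A ⨾ Δ → Realizes Γ Δ σ ν η → ⟦ A ⟧ (inst σ ν η t)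
    adequacy (ax x) E = λ-real E x
    adequacy {σ = σ} {ν} {η} (→i {t = t} {B = B'} d) E u a =
      saturated B' (β-red ◅ ε) (subst ⟦ B' ⟧ (sym e) (adequacy d (extendλ a E)))
      where
      e : sub 0 u (inst (↑ σ) ν (map shiftλ ∘ η) t) ≡ inst (u ◂ σ) ν η t
      e = trans (sub₀≡substλ u (inst (↑ σ) ν (map shiftλ ∘ η) t))
        (substλ-inst {θ = u ◂ var} {σ = ↑ σ} {η = map shiftλ ∘ η}
        (λ { zero → refl ; (suc x) → substλ-◂-shiftλ u (σ x) })
        (λ α → map-cancel (substλ-◂-shiftλ u) (η α)) t)
    adequacy (→e d e) E = adequacy d E _ (adequacy e E)
    adequacy {σ = σ} {ν} {η} (μ-rule {t = t} {A = A} d) E with orthogonal A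
    -- It is enough to test on each `vs` in `X`; this very stack is assigned to the bound name.
    ... | i , Ii , X , e = proj₂ (e _) λ vs x →
      let N , vs-fresh = mapFreshFrom vs
          -- Infinity of `C i` provides a name fresh for both `vs` and the environment.
          α , p , Cα = C-infinite i Ii (N ⊔ bound E)
          N≤α = ≤-trans (m≤m⊔n N (bound E)) p
          E≤α = ≤-trans (m≤n⊔m N (bound E)) p
          body = adequacy d (extendμ {vs = vs} Ii Cα (λ a → proj₁ (e _) a vs x) E)
          -- Binding the fresh `α` turns it into the name 0 and shifts everything else, which yields
          -- the term reached once `vs` has been consumed.
          rename = renμ-inst {κ = bindμ α} {σ = σ} {ν = α ◂ ν} {ν' = lift ν} {η = vs ◂ η}
            {η' = map shiftμ vs ◂ (map shiftμ ∘ η)}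
            (λ y → σ-fresh E y α E≤α)
            (λ { zero → bindμ-self α ; (suc β) → bindμ-fresh (≤-trans (ν-fresh E β) E≤α) })
            (λ { zero → vs-fresh α N≤α ; (suc β) → η-fresh E β α E≤α })
            t
      in B-saturated i Ii (apps-mu-▷* t [] vs)
           (subst (B i ∘ mu) rename (μ-closed i Ii α Cα _ body))
    adequacy (⊥-rule a d) E with μ-real E a
    ... | i , Ii , Cα , b = nam-closed i Ii _ Cα _ (b (adequacy d E))

    typed⇒⟦⟧ : ∀ {t A} → [] ⊢ t ∶ A ⨾ [] → ⟦ A ⟧ t
    typed⇒⟦⟧ {A = A} d = subst ⟦ A ⟧ (inst-id {σ = var} {λ _ → 0} {λ _ → []} d (λ ()) (λ ()))
      (adequacy d record
      { λ-real  = λ ()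
      ; μ-real  = λ ()
      -- `ν` is constantly 0, so 1 is the least strict bound; `σ` and `η` contain no names.
      ; bound   = 1
      ; σ-fresh = λ _ _ _ → refl
      ; ν-fresh = λ _ → ≤-refl
      ; η-fresh = λ _ _ _ → refl
      })

-- Scoping

scoped-mono : ∀ {n n' m m' t} → n ≤ n' → m ≤ m' → Scoped n m t → Scoped n' m' t
scoped-mono p q (s-var l)   = s-var (≤-trans l p)
scoped-mono p q (s-lam s)   = s-lam (scoped-mono (s≤s p) q s)
scoped-mono p q (s-app s r) = s-app (scoped-mono p q s) (scoped-mono p q r)
scoped-mono p q (s-mu s)    = s-mu (scoped-mono p (s≤s q) s)
scoped-mono p q (s-nam l s) = s-nam (≤-trans l q) (scoped-mono p q s)

scope : ∀ t → ∃ λ n → Scoped n n t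
scope (var x) = suc x , s-var ≤-refl
scope (lam t) with scope t
... | n , s = n , s-lam (scoped-mono (n≤1+n n) ≤-refl s)
scope (app t u) with scope t | scope u
... | n , s | m , r = n ⊔ m , s-app (scoped-mono (m≤m⊔n n m) (m≤m⊔n n m) s)
                                    (scoped-mono (m≤n⊔m n m) (m≤n⊔m n m) r)
scope (mu t) with scope t
... | n , s = n , s-mu (scoped-mono ≤-refl (n≤1+n n) s)
scope (nam α t) with scope t
... | n , s = suc α ⊔ n , s-nam (m≤m⊔n (suc α) n)
                                (scoped-mono (m≤n⊔m (suc α) n) (m≤n⊔m (suc α) n) s)

lift-< : ∀ {ρ n n'} → (∀ {x} → x < n → ρ x < n') → ∀ {x} → x < suc n → lift ρ x < suc n'
lift-< h {zero}  _       = s≤s z≤n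
lift-< h {suc x} (s≤s p) = s≤s (h p)

scoped-renλ : ∀ {n n' m ρ t} → (∀ {x} → x < n → ρ x < n') → Scoped n m t → Scoped n' m (renλ ρ t)
scoped-renλ h (s-var l)   = s-var (h l)
scoped-renλ h (s-lam s)   = s-lam (scoped-renλ (lift-< h) s)
scoped-renλ h (s-app s r) = s-app (scoped-renλ h s) (scoped-renλ h r)
scoped-renλ h (s-mu s)    = s-mu (scoped-renλ h s)
scoped-renλ h (s-nam l s) = s-nam l (scoped-renλ h s)

scoped-renμ : ∀ {n m m' κ t} → (∀ {α} → α < m → κ α < m') → Scoped n m t → Scoped n m' (renμ κ t)
scoped-renμ h (s-var l)   = s-var l
scoped-renμ h (s-lam s)   = s-lam (scoped-renμ h s)
scoped-renμ h (s-app s r) = s-app (scoped-renμ h s) (scoped-renμ h r)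
scoped-renμ h (s-mu s)    = s-mu (scoped-renμ (lift-< h) s)
scoped-renμ h (s-nam l s) = s-nam (h l) (scoped-renμ h s)

scoped-substλ : ∀ {n n' m θ t} → (∀ {x} → x < n → Scoped n' m (θ x)) →
  Scoped n m t → Scoped n' m (substλ θ t)
scoped-substλ h (s-var l)   = h l
scoped-substλ h (s-lam s)   = s-lam (scoped-substλ
  (λ { {zero} _ → s-var (s≤s z≤n) ; {suc x} (s≤s p) → scoped-renλ s≤s (h p) }) s)
scoped-substλ h (s-app s r) = s-app (scoped-substλ h s) (scoped-substλ h r)
scoped-substλ h (s-mu s)    = s-mu (scoped-substλ (scoped-renμ s≤s ∘ h) s)
scoped-substλ h (s-nam l s) = s-nam l (scoped-substλ h s)

scoped-msub : ∀ {n m v t} k → Scoped n m v → Scoped n m t → Scoped n m (msub k v t)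
scoped-msub k w (s-var l)   = s-var l
scoped-msub k w (s-lam s)   = s-lam (scoped-msub k (scoped-renλ s≤s w) s)
scoped-msub k w (s-app s r) = s-app (scoped-msub k w s) (scoped-msub k w r)
scoped-msub k w (s-mu s)    = s-mu (scoped-msub (suc k) (scoped-renμ s≤s w) s)
scoped-msub k w (s-nam {α = α} l s) with α ≡ᵇ k
... | true  = s-nam l (s-app (scoped-msub k w s) w)
... | false = s-nam l (scoped-msub k w s)

-- Ensures that a bound on the free variables of a term still holds for its reducts.
scoped-▷ : ∀ {n m t t'} → t ▷ t' → Scoped n m t → Scoped n m t'
scoped-▷ {n} {m} (β-red {u} {v}) (s-app (s-lam s) r) =
  subst (Scoped n m) (sym (sub₀≡substλ v u))
    (scoped-substλ (λ { {zero} _ → r ; {suc x} (s≤s p) → s-var p }) s)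
scoped-▷ μ-red (s-app (s-mu s) r)   = s-mu (scoped-msub 0 (scoped-renμ s≤s r) s)
scoped-▷ (c-lam p)  (s-lam s)   = s-lam (scoped-▷ p s)
scoped-▷ (c-appl p) (s-app s r) = s-app (scoped-▷ p s) r
scoped-▷ (c-appr p) (s-app s r) = s-app s (scoped-▷ p r)
scoped-▷ (c-mu p)   (s-mu s)    = s-mu (scoped-▷ p s)
scoped-▷ (c-nam p)  (s-nam l s) = s-nam l (scoped-▷ p s)

scoped-▷* : ∀ {n m t t'} → t ▷* t' → Scoped n m t → Scoped n m t'
scoped-▷* ε        s = s
scoped-▷* (r ◅ rs) s = scoped-▷* rs (scoped-▷ r s)

∋⇒< : ∀ {Γ x A} → Γ ∋ x ∶ A → x < length Γ
∋⇒< here      = s≤s z≤n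
∋⇒< (there a) = s≤s (∋⇒< a)

⊢⇒scoped : ∀ {Γ Δ t A} → Γ ⊢ t ∶ A ⨾ Δ → Scoped (length Γ) (length Δ) t
⊢⇒scoped (ax x)       = s-var (∋⇒< x)
⊢⇒scoped (→i d)       = s-lam (⊢⇒scoped d)
⊢⇒scoped (→e d e)     = s-app (⊢⇒scoped d) (⊢⇒scoped e)
⊢⇒scoped (μ-rule d)   = s-mu (⊢⇒scoped d)
⊢⇒scoped (⊥-rule a d) = s-nam (∋⇒< a) (⊢⇒scoped d)

-- Typing in infinite contexts

-- A relation and not a list, so that infinitely many variables can be declared at once.
Ctx : Set₁
Ctx = ℕ → Ty → Set

infixr 5 _∷ᶜ_

_∷ᶜ_ : Ty → Ctx → Ctx
A ∷ᶜ G = (_≡ A) ◂ G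

data Typed (G D : Ctx) : Term → Ty → Set where
  ax     : ∀ {x A} → G x A → Typed G D (var x) A
  →i     : ∀ {t A B} → Typed (A ∷ᶜ G) D t B → Typed G D (lam t) (A ⇒ B)
  →e     : ∀ {u v A B} → Typed G D u (A ⇒ B) → Typed G D v A → Typed G D (app u v) B
  μ-rule : ∀ {t A} → Typed G (A ∷ᶜ D) t bot → Typed G D (mu t) A
  ⊥-rule : ∀ {α t A} → D α A → Typed G D t A → Typed G D (nam α t) bot

typed-renμ : ∀ {G D D' κ t A} → (∀ {α B} → D α B → D' (κ α) B) →
  Typed G D t A → Typed G D' (renμ κ t) A
typed-renμ h (ax x)       = ax x
typed-renμ h (→i d)       = →i (typed-renμ h d)
typed-renμ h (→e d e)     = →e (typed-renμ h d) (typed-renμ h e)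
typed-renμ h (μ-rule d)   = μ-rule (typed-renμ (λ { {zero} e → e ; {suc α} a → h a }) d)
typed-renμ h (⊥-rule a d) = ⊥-rule (h a) (typed-renμ h d)

-- Only variables in scope are looked up. If nothing below `n` and `m` is declared, `Γ` and `Δ` can
-- be empty.
typed⇒⊢ : ∀ {n m Γ Δ G D t A} → Scoped n m t →
  (∀ {x B} → x < n → G x B → Γ ∋ x ∶ B) →
  (∀ {α B} → α < m → D α B → Δ ∋ α ∶ B) →
  Typed G D t A → Γ ⊢ t ∶ A ⨾ Δ
typed⇒⊢ (s-var l) h k (ax x) = ax (h l x)
typed⇒⊢ (s-lam s) h k (→i d) =
  →i (typed⇒⊢ s (λ { {zero} _ refl → here ; {suc x} (s≤s p) b → there (h p b) }) k d)
typed⇒⊢ (s-app s r) h k (→e d e) = →e (typed⇒⊢ s h k d) (typed⇒⊢ r h k e)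
typed⇒⊢ (s-mu s) h k (μ-rule d) =
  μ-rule (typed⇒⊢ s h (λ { {zero} _ refl → here ; {suc α} (s≤s p) b → there (k p b) }) d)
typed⇒⊢ (s-nam l s) h k (⊥-rule a d) = ⊥-rule (k l a) (typed⇒⊢ s h k d)

-- Undoing the application to a λ-variable

-- u ≈[ ρ , s , x ] v : v arises from u by renaming every λ-variable y to ρ y, replacing every
-- (α w) with α marked by s by (α (w x)), and then possibly reducing some of these (w x).
-- u ≈•[ ρ , s , x ] v : likewise with v arising from (u x). When a λ-abstraction or a
-- μ-abstraction has consumed x, its bound variable is sent to x, respectively marked.
mutual
  data _≈[_,_,_]_ : Term → (ℕ → ℕ) → (ℕ → Bool) → ℕ → Term → Set where
    var  : ∀ {ρ s x y z} → ρ y ≡ z → var y ≈[ ρ , s , x ] var z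
    lam  : ∀ {ρ s x u v} → u ≈[ lift ρ , s , suc x ] v → lam u ≈[ ρ , s , x ] lam v
    app  : ∀ {ρ s x u u' v v'} → u ≈[ ρ , s , x ] v → u' ≈[ ρ , s , x ] v' →
           app u u' ≈[ ρ , s , x ] app v v'
    mu   : ∀ {ρ s x u v} → u ≈[ ρ , false ◂ s , x ] v → mu u ≈[ ρ , s , x ] mu v
    nam  : ∀ {ρ s x α u v} → s α ≡ false → u ≈[ ρ , s , x ] v → nam α u ≈[ ρ , s , x ] nam α v
    nam• : ∀ {ρ s x α u v} → s α ≡ true → u ≈•[ ρ , s , x ] v → nam α u ≈[ ρ , s , x ] nam α v

  data _≈•[_,_,_]_ : Term → (ℕ → ℕ) → (ℕ → Bool) → ℕ → Term → Set where
    arg : ∀ {ρ s x u v} → u ≈[ ρ , s , x ] v → u ≈•[ ρ , s , x ] app v (var x)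
    lam : ∀ {ρ s x u v} → u ≈[ x ◂ ρ , s , x ] v → lam u ≈•[ ρ , s , x ] v
    mu  : ∀ {ρ s x u v} → u ≈[ ρ , true ◂ s , x ] v → mu u ≈•[ ρ , s , x ] mu v

≈-refl : ∀ {ρ s x} → (∀ y → ρ y ≡ y) → (∀ α → s α ≡ false) → ∀ t → t ≈[ ρ , s , x ] t
≈-refl e f (var y)   = var (e y)
≈-refl e f (lam t)   = lam (≈-refl (lift-id e) f t)
≈-refl e f (app t u) = app (≈-refl e f t) (≈-refl e f u)
≈-refl e f (mu t)    = mu (≈-refl e (λ { zero → refl ; (suc α) → f α }) t)
≈-refl e f (nam α t) = nam (f α) (≈-refl e f t)

mutual
  -- Two renamings, because a λ-abstraction that has consumed `x` binds on the left only. The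
  -- μ-binders agree on both sides, so one renaming serves in `≈-renμ`.
  ≈-renλ : ∀ {κ κ' ρ ρ' s x x' u v} → (∀ y → ρ' (κ y) ≡ κ' (ρ y)) → κ' x ≡ x' →
    u ≈[ ρ , s , x ] v → renλ κ u ≈[ ρ' , s , x' ] renλ κ' v
  ≈-renλ e refl (var refl) = var (e _)
  ≈-renλ e refl (lam r)    = lam (≈-renλ (lift-square e) refl r)
  ≈-renλ e refl (app r q)  = app (≈-renλ e refl r) (≈-renλ e refl q)
  ≈-renλ e refl (mu r)     = mu (≈-renλ e refl r)
  ≈-renλ e refl (nam f r)  = nam f (≈-renλ e refl r)
  ≈-renλ e refl (nam• f r) = nam• f (≈•-renλ e refl r)

  ≈•-renλ : ∀ {κ κ' ρ ρ' s x x' u v} → (∀ y → ρ' (κ y) ≡ κ' (ρ y)) → κ' x ≡ x' →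
    u ≈•[ ρ , s , x ] v → renλ κ u ≈•[ ρ' , s , x' ] renλ κ' v
  ≈•-renλ e refl (arg r) = arg (≈-renλ e refl r)
  ≈•-renλ e refl (lam r) = lam (≈-renλ (λ { zero → refl ; (suc y) → e y }) refl r)
  ≈•-renλ e refl (mu r)  = mu (≈-renλ e refl r)

mutual
  ≈-renμ : ∀ {κ ρ s s' x u v} → (∀ α → s' (κ α) ≡ s α) →
    u ≈[ ρ , s , x ] v → renμ κ u ≈[ ρ , s' , x ] renμ κ v
  ≈-renμ e (var p)    = var p
  ≈-renμ e (lam r)    = lam (≈-renμ e r)
  ≈-renμ e (app r q)  = app (≈-renμ e r) (≈-renμ e q)
  ≈-renμ e (mu r)     = mu (≈-renμ (λ { zero → refl ; (suc α) → e α }) r)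
  ≈-renμ e (nam f r)  = nam (trans (e _) f) (≈-renμ e r)
  ≈-renμ e (nam• f r) = nam• (trans (e _) f) (≈•-renμ e r)

  ≈•-renμ : ∀ {κ ρ s s' x u v} → (∀ α → s' (κ α) ≡ s α) →
    u ≈•[ ρ , s , x ] v → renμ κ u ≈•[ ρ , s' , x ] renμ κ v
  ≈•-renμ e (arg r) = arg (≈-renμ e r)
  ≈•-renμ e (lam r) = lam (≈-renμ e r)
  ≈•-renμ e (mu r)  = mu (≈-renμ (λ { zero → refl ; (suc α) → e α }) r)

≈-shiftλˡ : ∀ {ρ s x y u v} → u ≈[ ρ , s , x ] v → shiftλ u ≈[ y ◂ ρ , s , x ] v
≈-shiftλˡ {v = v} r = subst (_ ≈[ _ , _ , _ ]_) (renλ-id (λ _ → refl) v) (≈-renλ (λ _ → refl) refl r)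

≈-shiftμ : ∀ {ρ s x b u v} → u ≈[ ρ , s , x ] v → shiftμ u ≈[ ρ , b ◂ s , x ] shiftμ v
≈-shiftμ = ≈-renμ (λ _ → refl)

mutual
  -- `θ'` must send `x` to a variable, since `arg` records an application to a variable.
  ≈-substλ : ∀ {θ θ' ρ ρ' s x x' u v} → (∀ y → θ y ≈[ ρ' , s , x' ] θ' (ρ y)) → θ' x ≡ var x' →
    u ≈[ ρ , s , x ] v → substλ θ u ≈[ ρ' , s , x' ] substλ θ' v
  ≈-substλ h e (var refl) = h _
  ≈-substλ h e (lam r)    = lam (≈-substλ
    (λ { zero → var refl ; (suc y) → ≈-renλ (λ _ → refl) refl (h y) }) (cong shiftλ e) r)
  ≈-substλ h e (app r q)  = app (≈-substλ h e r) (≈-substλ h e q)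
  ≈-substλ h e (mu r)     = mu (≈-substλ (≈-shiftμ ∘ h) (cong shiftμ e) r)
  ≈-substλ h e (nam f r)  = nam f (≈-substλ h e r)
  ≈-substλ h e (nam• f r) = nam• f (≈•-substλ h e r)

  ≈•-substλ : ∀ {θ θ' ρ ρ' s x x' u v} → (∀ y → θ y ≈[ ρ' , s , x' ] θ' (ρ y)) → θ' x ≡ var x' →
    u ≈•[ ρ , s , x ] v → substλ θ u ≈•[ ρ' , s , x' ] substλ θ' v
  ≈•-substλ h e (arg r) rewrite e = arg (≈-substλ h e r)
  ≈•-substλ h e (lam r) = lam (≈-substλ
    (λ { zero → subst (var 0 ≈[ _ , _ , _ ]_) (sym e) (var refl) ; (suc y) → ≈-shiftλˡ (h y) }) e r)
  ≈•-substλ h e (mu r)  = mu (≈-substλ (≈-shiftμ ∘ h) (cong shiftμ e) r)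

true≢false : true ≢ false
true≢false ()

mutual
  -- For the contraction of a μ-redex present on both sides, whose bound name is unmarked. At a
  -- marked name the right side would have received `x` before `b`, and the two sides would
  -- disagree.
  ≈-msub : ∀ {k ρ s x a b u v} → s k ≡ false → a ≈[ ρ , s , x ] b →
    u ≈[ ρ , s , x ] v → msub k a u ≈[ ρ , s , x ] msub k b v
  ≈-msub e q (var p)   = var p
  ≈-msub e q (lam r)   = lam (≈-msub e (≈-renλ (λ _ → refl) refl q) r)
  ≈-msub e q (app r p) = app (≈-msub e q r) (≈-msub e q p)
  ≈-msub e q (mu r)    = mu (≈-msub e (≈-shiftμ q) r)
  ≈-msub {k} e q (nam {α = α} f r) with α ≡ᵇ k
  ... | true  = nam f (app (≈-msub e q r) q)
  ... | false = nam f (≈-msub e q r)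
  ≈-msub {k} e q (nam• {α = α} f r) with α ≡ᵇ k in g
  ... | false = nam• f (≈•-msub e q r)
  ... | true with refl ← ≡ᵇ⇒≡ α k (subst T (sym g) tt) = ⊥-elim (true≢false (trans (sym f) e))

  ≈•-msub : ∀ {k ρ s x a b u v} → s k ≡ false → a ≈[ ρ , s , x ] b →
    u ≈•[ ρ , s , x ] v → msub k a u ≈•[ ρ , s , x ] msub k b v
  ≈•-msub e q (arg r) = arg (≈-msub e q r)
  ≈•-msub e q (lam r) = lam (≈-msub e (≈-shiftλˡ q) r)
  ≈•-msub e q (mu r)  = mu (≈-msub e (≈-shiftμ q) r)

Marks : ℕ → (ℕ → Bool) → (ℕ → Bool) → Set
Marks k s s' = s' k ≡ true × (∀ α → (α ≡ᵇ k) ≡ false → s' α ≡ s α)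

marks-◂ : ∀ {b k s s'} → Marks k s s' → Marks (suc k) (b ◂ s) (b ◂ s')
marks-◂ (m , h) = m , λ { zero _ → refl ; (suc α) → h α }

mutual
  -- When a μ-abstraction on the right consumes `x`, the left side stays as it is: the new
  -- applications to `x` are exactly what marking `k` allows.
  ≈-mark : ∀ {k ρ s s' x u v} → s k ≡ false → Marks k s s' →
    u ≈[ ρ , s , x ] v → u ≈[ ρ , s' , x ] msub k (var x) v
  ≈-mark e m (var p)   = var p
  ≈-mark e m (lam r)   = lam (≈-mark e m r)
  ≈-mark e m (app r q) = app (≈-mark e m r) (≈-mark e m q)
  ≈-mark e m (mu r)    = mu (≈-mark e (marks-◂ m) r)
  ≈-mark {k} e m (nam {α = α} f r) with α ≡ᵇ k in g
  ... | false = nam (trans (proj₂ m α g) f) (≈-mark e m r)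
  ... | true with refl ← ≡ᵇ⇒≡ α k (subst T (sym g) tt) = nam• (proj₁ m) (arg (≈-mark e m r))
  ≈-mark {k} e m (nam• {α = α} f r) with α ≡ᵇ k in g
  ... | false = nam• (trans (proj₂ m α g) f) (≈•-mark e m r)
  ... | true with refl ← ≡ᵇ⇒≡ α k (subst T (sym g) tt) = ⊥-elim (true≢false (trans (sym f) e))

  ≈•-mark : ∀ {k ρ s s' x u v} → s k ≡ false → Marks k s s' →
    u ≈•[ ρ , s , x ] v → u ≈•[ ρ , s' , x ] msub k (var x) v
  ≈•-mark e m (arg r) = arg (≈-mark e m r)
  ≈•-mark e m (lam r) = lam (≈-mark e m r)
  ≈•-mark e m (mu r)  = mu (≈-mark e (marks-◂ m) r)

≈-β : ∀ {ρ s x a b u v} → u ≈[ lift ρ , s , suc x ] v → a ≈[ ρ , s , x ] b →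
  sub 0 a u ≈[ ρ , s , x ] sub 0 b v
≈-β {a = a} {b} {u} {v} r q = subst₂ (_≈[ _ , _ , _ ]_)
  (sym (sub₀≡substλ a u)) (sym (sub₀≡substλ b v))
  (≈-substλ (λ { zero → q ; (suc y) → var refl }) refl r)

-- When a λ-abstraction on the right consumes `x`, the left side keeps its binder, whose variable
-- now corresponds to `x`.
≈-β-var : ∀ {ρ s x u v} → u ≈[ lift ρ , s , suc x ] v → u ≈[ x ◂ ρ , s , x ] sub 0 (var x) v
≈-β-var {x = x} {u} {v} r = subst₂ (_≈[ _ , _ , _ ]_)
  (substλ-id {var} (λ _ → refl) u) (sym (sub₀≡substλ (var x) v))
  (≈-substλ (λ { zero → var refl ; (suc y) → var refl }) refl r)

mutual
  -- `≈` preserves the head constructor, so a redex on the right that does not come from `arg` is a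
  -- redex on the left as well. A redex whose argument is the recorded `x` costs no step on the
  -- left.
  ≈-simulate : ∀ {ρ s x u v v'} → u ≈[ ρ , s , x ] v → v ▷ v' →
    ∃ λ u' → u ▷* u' × u' ≈[ ρ , s , x ] v'
  ≈-simulate (app (lam r) q) β-red = _ , β-red ◅ ε , ≈-β r q
  ≈-simulate (app (mu r) q) μ-red  = _ , μ-red ◅ ε , mu (≈-msub refl (≈-shiftμ q) r)
  ≈-simulate (lam r) (c-lam p) with ≈-simulate r p
  ... | u' , ps , r' = lam u' , gmap lam c-lam ps , lam r'
  ≈-simulate (app r q) (c-appl p) with ≈-simulate r p
  ... | u' , ps , r' = _ , gmap (λ t → app t _) c-appl ps , app r' q
  ≈-simulate (app r q) (c-appr p) with ≈-simulate q p
  ... | u' , ps , q' = _ , gmap (app _) c-appr ps , app r q'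
  ≈-simulate (mu r) (c-mu p) with ≈-simulate r p
  ... | u' , ps , r' = mu u' , gmap mu c-mu ps , mu r'
  ≈-simulate (nam f r) (c-nam p) with ≈-simulate r p
  ... | u' , ps , r' = _ , gmap (nam _) c-nam ps , nam f r'
  ≈-simulate (nam• f r) (c-nam p) with ≈•-simulate r p
  ... | u' , ps , r' = _ , gmap (nam _) c-nam ps , nam• f r'

  ≈•-simulate : ∀ {ρ s x u v v'} → u ≈•[ ρ , s , x ] v → v ▷ v' →
    ∃ λ u' → u ▷* u' × u' ≈•[ ρ , s , x ] v'
  ≈•-simulate (arg (lam r)) β-red = _ , ε , lam (≈-β-var r)
  ≈•-simulate (arg (mu r)) μ-red  =
    _ , ε , mu (≈-mark refl (refl , λ { zero () ; (suc α) _ → refl }) r)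
  ≈•-simulate (arg r) (c-appl p) with ≈-simulate r p
  ... | u' , ps , r' = u' , ps , arg r'
  ≈•-simulate (lam r) p with ≈-simulate r p
  ... | u' , ps , r' = lam u' , gmap lam c-lam ps , lam r'
  ≈•-simulate (mu r) (c-mu p) with ≈-simulate r p
  ... | u' , ps , r' = mu u' , gmap mu c-mu ps , mu r'

≈•-simulate* : ∀ {ρ s x u v v'} → u ≈•[ ρ , s , x ] v → v ▷* v' →
  ∃ λ u' → u ▷* u' × u' ≈•[ ρ , s , x ] v'
≈•-simulate* r ε = _ , ε , r
≈•-simulate* r (p ◅ ps) with ≈•-simulate r p
... | u₁ , qs , r₁ with ≈•-simulate* r₁ ps
... | u₂ , qs' , r₂ = u₂ , qs ◅◅ qs' , r₂

-- If x : A, then a marked μ-variable of type B on the right has type A ⇒ B on the left.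
record Reflects (A : Ty) (ρ : ℕ → ℕ) (s : ℕ → Bool) (x : ℕ) (G D G' D' : Ctx) : Set where
  field
    onλ      : ∀ {y B} → G' (ρ y) B → G y B
    at-x     : ∀ {B} → G' x B → B ≡ A
    unmarked : ∀ {α B} → s α ≡ false → D' α B → D α B
    marked   : ∀ {α B} → s α ≡ true → D' α B → D α (A ⇒ B)

open Reflects

mutual
  -- The derivation on the right is followed and rebuilt on the left; at marked names the missing
  -- argument `x` turns `B` into `A ⇒ B`.
  ≈-typed : ∀ {A ρ s x G D G' D' u v B} → Reflects A ρ s x G D G' D' →
    u ≈[ ρ , s , x ] v → Typed G' D' v B → Typed G D u B
  ≈-typed R (var refl) (ax g)  = ax (onλ R g)
  ≈-typed R (lam r) (→i d)     = →i (≈-typed (record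
    { onλ      = λ { {zero} e → e ; {suc y} g → onλ R g }
    ; at-x     = at-x R
    ; unmarked = unmarked R
    ; marked   = marked R }) r d)
  ≈-typed R (app r q) (→e d e) = →e (≈-typed R r d) (≈-typed R q e)
  ≈-typed R (mu r) (μ-rule d)  = μ-rule (≈-typed (record
    { onλ      = onλ R
    ; at-x     = at-x R
    ; unmarked = λ { {zero} _ e → e ; {suc α} → unmarked R }
    ; marked   = λ { {zero} () ; {suc α} → marked R } }) r d)
  ≈-typed R (nam f r) (⊥-rule a d)  = ⊥-rule (unmarked R f a) (≈-typed R r d)
  ≈-typed R (nam• f r) (⊥-rule a d) = ⊥-rule (marked R f a) (≈•-typed R r d)

  ≈•-typed : ∀ {A ρ s x G D G' D' u v B} → Reflects A ρ s x G D G' D' →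
    u ≈•[ ρ , s , x ] v → Typed G' D' v B → Typed G D u (A ⇒ B)
  -- The domain in `d` is a type of `x`, hence `A`.
  ≈•-typed R (arg r) (→e d (ax g)) with refl ← at-x R g = ≈-typed R r d
  ≈•-typed R (lam r) d = →i (≈-typed (record
    { onλ      = λ { {zero} g → at-x R g ; {suc y} g → onλ R g }
    ; at-x     = at-x R
    ; unmarked = unmarked R
    ; marked   = marked R }) r d)
  ≈•-typed {A} R (mu r) (μ-rule d) = μ-rule (≈-typed (record
    { onλ      = onλ R
    ; at-x     = at-x R
    ; unmarked = λ { {zero} () ; {suc α} → unmarked R }
    ; marked   = λ { {zero} _ e → cong (A ⇒_) e ; {suc α} → marked R } }) r d)

-- `t` and `app t (var x)` are related by `arg`, with no renaming and no marks. The relation tracks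
-- positions, so `x` may also occur in `t`.
typed-app-var⁻¹ : ∀ {G D x A B t v} → (∀ {C} → G x C → C ≡ A) → app t (var x) ▷* v → Typed G D v B →
  ∃ λ t' → t ▷* t' × Typed G D t' (A ⇒ B)
typed-app-var⁻¹ {t = t} e r d
  with ≈•-simulate* {id} {λ _ → false} (arg (≈-refl (λ _ → refl) (λ _ → refl) t)) r
... | t' , r' , q = t' , r' , ≈•-typed (record
  { onλ = id ; at-x = e ; unmarked = λ _ → id ; marked = λ () }) q d

-- Enumerations

-- Cantor's walk along the antidiagonals, each from `(a , 0)` to `(0 , a)`.
next : ℕ × ℕ → ℕ × ℕ
next (zero , b)  = suc b , zero
next (suc a , b) = a , suc b

unpair : ℕ → ℕ × ℕ
unpair zero    = 0 , 0
unpair (suc n) = next (unpair n)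

descend : ∀ b a → (∃ λ n → unpair n ≡ (b + a , 0)) → ∃ λ n → unpair n ≡ (a , b)
descend zero    a h = h
descend (suc b) a h
  with descend b (suc a) (subst (λ c → ∃ λ n → unpair n ≡ (c , 0)) (sym (+-suc b a)) h)
... | n , e = suc n , cong next e

unpair-axis : ∀ a → ∃ λ n → unpair n ≡ (a , 0)
unpair-axis zero = 0 , refl
unpair-axis (suc a)
  with descend a 0 (subst (λ c → ∃ λ n → unpair n ≡ (c , 0)) (sym (+-identityʳ a)) (unpair-axis a))
... | n , e = suc n , cong next e

unpair-surjective : ∀ a b → ∃ λ n → unpair n ≡ (a , b)
unpair-surjective a b = descend b a (unpair-axis (b + a))

abstract
  pair : ℕ → ℕ → ℕ
  pair a b = proj₁ (unpair-surjective a b)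

  unpair-pair : ∀ a b → unpair (pair a b) ≡ (a , b)
  unpair-pair a b = proj₂ (unpair-surjective a b)

pair-injective : ∀ {a b a' b'} → pair a b ≡ pair a' b' → (a , b) ≡ (a' , b')
pair-injective {a} {b} {a'} {b'} e =
  trans (sym (unpair-pair a b)) (trans (cong unpair e) (unpair-pair a' b'))

next-bound : ∀ p {n} → proj₁ p + proj₂ p ≤ n → proj₁ (next p) + proj₂ (next p) ≤ suc n
next-bound (zero , b)  h rewrite +-identityʳ b = s≤s h
next-bound (suc a , b) h rewrite +-suc a b = ≤-trans h (n≤1+n _)

unpair-bound : ∀ n → proj₁ (unpair n) + proj₂ (unpair n) ≤ n
unpair-bound zero    = z≤n
unpair-bound (suc n) = next-bound (unpair n) (unpair-bound n)

-- Makes every class of names unbounded. It holds because the sum of the coordinates grows by at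
-- most one per step of the walk.
pair-bound : ∀ a b → b ≤ pair a b
pair-bound a b = ≤-trans (m≤n+m b a)
  (subst (λ p → proj₁ p + proj₂ p ≤ pair a b) (unpair-pair a b) (unpair-bound (pair a b)))

-- Reserves a λ-variable for each type; the tags 0, 1, 2 keep the constructors apart.
code : Ty → ℕ
code (atom X) = pair 0 X
code bot      = pair 1 0
code (A ⇒ B)  = pair 2 (pair (code A) (code B))

code-injective : ∀ A B → code A ≡ code B → A ≡ B
code-injective (atom X) (atom Y) e with refl ← pair-injective e = refl
code-injective (atom X) bot      e with () ← pair-injective e
code-injective (atom X) (_ ⇒ _)  e with () ← pair-injective e
code-injective bot      (atom Y) e with () ← pair-injective e
code-injective bot      bot      e = refl
code-injective bot      (_ ⇒ _)  e with () ← pair-injective e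
code-injective (_ ⇒ _)  (atom Y) e with () ← pair-injective e
code-injective (_ ⇒ _)  bot      e with () ← pair-injective e
code-injective (A ⇒ B)  (A' ⇒ B') e = cong₂ _⇒_
  (code-injective A A' (cong proj₁ args)) (code-injective B B' (cong proj₂ args))
  where args = pair-injective (cong proj₂ (pair-injective e))

-- The model of typable terms

-- ℬ_0 realizes ⊥ and ℬ_(1+X) realizes X.
ty : ℕ → Ty
ty zero    = bot
ty (suc X) = atom X

-- The variables below n are left undeclared: they are meant to contain the free variables of
-- the term under study, so that its typable reducts are closed.
module Completeness (n : ℕ) where

  𝔾 : Ctx
  𝔾 x A = x ≡ n + code A

  class : ℕ → ℕ
  class α = proj₁ (unpair α)

  𝔻 : Ctx
  𝔻 α A = n ≤ α × A ≡ ty (class α)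

  𝓑 : Ty → TSet
  𝓑 A t = ∃ λ t' → t ▷* t' × Typed 𝔾 𝔻 t' A

  𝔾-functional : ∀ {x A A'} → 𝔾 x A → 𝔾 x A' → A' ≡ A
  𝔾-functional {A = A} {A'} e e' = code-injective A' A (+-cancelˡ-≡ n _ _ (trans (sym e') e))

  𝓑-saturated : ∀ A → Saturated (𝓑 A)
  𝓑-saturated A r (t' , r' , d) = t' , r ◅◅ r' , d

  𝓑-var : ∀ A → 𝓑 A (var (n + code A))
  𝓑-var A = _ , ε , ax refl

  𝓑-μ : ∀ {α u} → 𝓑 bot u → n ≤ α → 𝓑 (ty (class α)) (μ[ α ] u)
  𝓑-μ {α} (u' , r , d) n≤α = _ , gmap mu c-mu (gmap (renμ _) renμ-▷ r) , μ-rule (typed-renμ bind d)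
    where
    bind : ∀ {β B} → 𝔻 β B → (ty (class α) ∷ᶜ 𝔻) (bindμ α β) B
    bind {β} b with β ≡ᵇ α in e
    ... | false = b
    -- The type that `𝔻` gives to `α` is the one required of the bound name.
    ... | true with refl ← ≡ᵇ⇒≡ β α (subst T (sym e) tt) = proj₂ b

  model : Model
  model = record
    { I           = λ _ → ⊤
    ; J           = λ _ → ⊥
    ; 0∈I         = tt
    ; C           = λ i α → n ≤ α × class α ≡ i
    ; B           = 𝓑 ∘ ty
    ; R           = λ _ _ → ⊥
    -- Pairing with `n + m` makes the name at least `m`, as infinity demands, and at least `n`, so
    -- that it is declared.
    ; C-infinite  = λ i _ m → let p = pair-bound i (n + m) in
        pair i (n + m) , ≤-trans (m≤n+m m n) p ,
        ≤-trans (m≤m+n n m) p , cong proj₁ (unpair-pair i (n + m))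
    ; C-disjoint  = λ { i j _ _ i≢j α (_ , refl) (_ , e) → i≢j e }
    ; B-nonempty  = λ i _ → _ , 𝓑-var (ty i)
    ; B-saturated = λ i _ → 𝓑-saturated (ty i)
    ; R-nonempty  = λ _ ()
    ; R-saturated = λ _ ()
    ; μ-closed    = λ { i _ α (n≤α , refl) u b → 𝓑-μ b n≤α }
    ; nam-closed  = λ { i _ α (n≤α , refl) u (u' , r , d) →
        nam α u' , gmap (nam α) c-nam r , ⊥-rule (n≤α , refl) d }
    ; R-index     = λ _ → 0
    ; R-X         = λ _ _ → ⊥
    ; R-form      = λ _ ()
    }

  interp : Interp model
  interp X = cB (suc X) tt

  interp≐𝓑 : ∀ A → ⟦_⟧ty model A interp ≐ 𝓑 A
  interp≐𝓑 (atom X) t = id , id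
  interp≐𝓑 bot      t = id , id
  interp≐𝓑 (A ⇒ B)  t = to , from
    where
    to : ⟦_⟧ty model (A ⇒ B) interp t → 𝓑 (A ⇒ B) t
    -- One test is enough: the variable reserved for `A`, whose only type in `𝔾` is `A`.
    to f with proj₁ (interp≐𝓑 B _) (f _ (proj₂ (interp≐𝓑 A _) (𝓑-var A)))
    ... | v , r , d = typed-app-var⁻¹ (𝔾-functional refl) r d

    from : 𝓑 (A ⇒ B) t → ⟦_⟧ty model (A ⇒ B) interp t
    from (t' , r , d) u a with proj₁ (interp≐𝓑 A u) a
    ... | u' , q , e = proj₂ (interp≐𝓑 B _)
      (app t' u' , gmap (λ w → app w u) c-appl r ◅◅ gmap (app t') c-appr q , →e d e)

  reducesToTyped : ∀ {A t} → Scoped n n t → ∣_∣[M] model A t →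
    ∃ λ t' → t ▷* t' × Closed t' × ([] ⊢ t' ∶ A ⨾ [])
  reducesToTyped {A} {t} s h with proj₁ (interp≐𝓑 A t) (h interp)
  ... | t' , r , d = t' , r , ⊢⇒scoped d' , d'
    where
    d' = typed⇒⊢ (scoped-▷* r s)
      -- The reduct has its free variables below `n`, where neither `𝔾` nor `𝔻` declares anything.
      (λ { p refl → ⊥-elim (<⇒≱ p (m≤m+n n _)) })
      (λ p b → ⊥-elim (<⇒≱ p (proj₁ b)))
      d

theorem3p10 : (A : Ty) (t : Term) →
    (∣ A ∣ t → ∃ λ t' → t ▷* t' × Closed t' × ([] ⊢ t' ∶ A ⨾ []))
    × ((∃ λ t' → t ▷* t' × Closed t' × ([] ⊢ t' ∶ A ⨾ [])) → ∣ A ∣ t)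
theorem3p10 A t = complete , sound
  where
  complete : ∣ A ∣ t → ∃ λ t' → t ▷* t' × Closed t' × ([] ⊢ t' ∶ A ⨾ [])
  -- The model depends on `t` through `n`, a bound on its free variables of both kinds.
  complete h with scope t
  ... | n , s = Completeness.reducesToTyped n s (h (Completeness.model n))

  sound : (∃ λ t' → t ▷* t' × Closed t' × ([] ⊢ t' ∶ A ⨾ [])) → ∣ A ∣ t
  sound (t' , r , _ , d) M ℐ = saturated ℐ A r (typed⇒⟦⟧ ℐ d)
    where open Soundness M
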